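{- $\Omega(\eta)$ is equimorphic, as a join-semilattice, to every member of $\mathcal{L_D}$.
   Context: $\Omega(\eta)$ denotes the join-subsemilattice of the direct product $\mathbb{N}\times D$ (componentwise order), where $\mathbb{N}$ is the chain of non-negative integers and $D$ is the chain of dyadic rationals in $[0,1)$, consisting of the pairs $(n,r)$ with $2^n r\in\mathbb{Z}$. A bichain is a triple $B=(X,\leq_1,\leq_2)$ with $\leq_1,\leq_2$ linear orders on a set $X$; $C(B)$ denotes the closure system on $X$ whose closed sets are the sets $I_1\cap I_2$ with $I_k$ an initial segment of $(X,\leq_k)$, ordered by inclusion (an algebraic lattice), and $K(C(B))$ is the join-semilattice of its compact elements (the closures of finite subsets of $X$). $\mathcal{L_D}$ is the class of join-semilattices isomorphic to $K(C(B))$ for some bichain $B$ whose first component $(X,\leq_1)$ has order type $\omega$ and whose second component $(X,\leq_2)$ is not order-scattered (contains a copy of $\mathbb{Q}$). Two join-semilattices are equimorphic as join-semilattices if each embeds into the other by a one-to-one join-preserving map. -}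

module Defs where

open import Level using (Level; 0ℓ; _⊔_) renaming (suc to lsuc)
open import Algebra.Bundles.Raw using (RawMagma)
open import Algebra.Morphism.Structures using (module MagmaMorphisms)
import Algebra.Construct.NaturalChoice.Max as Max
open import Data.Integer.Base as ℤ using (ℤ)
import Data.Integer.Properties as ℤ
open import Data.List.Base using (List; []; _∷_; _++_)
open import Data.List.Membership.Propositional using (_∈_)
open import Data.List.Relation.Unary.All as All using (All; []; _∷_)
open import Data.List.Relation.Unary.All.Properties using (++⁺)
open import Data.List.Relation.Unary.Any using (here; there)
open import Data.List.Membership.Propositional.Properties using (∈-++⁺ˡ; ∈-++⁺ʳ)
open import Data.Nat.Base as ℕ using (ℕ)
import Data.Nat.Properties as ℕ
open import Data.Product.Base using (Σ; Σ-syntax; ∃-syntax; _×_; _,_; proj₁; proj₂)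
open import Data.Product.Relation.Binary.Pointwise.NonDependent using (Pointwise; ×-isPartialOrder)
open import Data.Rational.Base as ℚ using (ℚ; 0ℚ; 1ℚ)
import Data.Rational.Properties as ℚ
import Data.Rational.Unnormalised.Base as ℚᵘ
import Data.Rational.Unnormalised.Properties as ℚᵘ
open import Data.Sum.Base using (_⊎_; inj₁; inj₂)
open import Function.Base using (_on_)
open import Relation.Binary.Bundles using (DecTotalOrder; TotalOrder)
open import Relation.Binary.Core using (Rel)
open import Relation.Binary.Lattice.Bundles using (JoinSemilattice)
open import Relation.Binary.Morphism.Structures using (IsOrderMonomorphism; IsOrderIsomorphism)
import Relation.Binary.Construct.On as On
open import Relation.Binary.PropositionalEquality as ≡ using (_≡_; refl; sym; cong; subst; module ≡-Reasoning)
open import Relation.Binary.Structures using (IsTotalOrder)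
open import Relation.Unary using (Pred; _⊆_; _≐_; _∩_; _∪_)

private
  variable
    a b p ℓ ℓ₁ ℓ₂ ℓ₃ ℓ₄ : Level

∨-rawMagma : JoinSemilattice a ℓ₁ ℓ₂ → RawMagma a ℓ₁
∨-rawMagma L = record { _≈_ = L._≈_ ; _∙_ = L._∨_ }
  where module L = JoinSemilattice L

infix 4 _↪_ _≅_

-- Only binary joins have to be preserved, not a least element.
_↪_ : JoinSemilattice a ℓ₁ ℓ₂ → JoinSemilattice b ℓ₃ ℓ₄ → Set (a ⊔ b ⊔ ℓ₁ ⊔ ℓ₃)
L ↪ M = Σ[ f ∈ (L.Carrier → M.Carrier) ] IsMagmaMonomorphism f
  where
  module L = JoinSemilattice L
  module M = JoinSemilattice M
  open MagmaMorphisms (∨-rawMagma L) (∨-rawMagma M)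

_≅_ : JoinSemilattice a ℓ₁ ℓ₂ → JoinSemilattice b ℓ₃ ℓ₄ → Set (a ⊔ b ⊔ ℓ₁ ⊔ ℓ₃)
L ≅ M = Σ[ f ∈ (L.Carrier → M.Carrier) ] IsMagmaIsomorphism f
  where
  module L = JoinSemilattice L
  module M = JoinSemilattice M
  open MagmaMorphisms (∨-rawMagma L) (∨-rawMagma M)

Equimorphic : JoinSemilattice a ℓ₁ ℓ₂ → JoinSemilattice b ℓ₃ ℓ₄ → Set (a ⊔ b ⊔ ℓ₁ ⊔ ℓ₃)
Equimorphic L M = (L ↪ M) × (M ↪ L)

chain : TotalOrder a ℓ₁ ℓ₂ → JoinSemilattice a ℓ₁ ℓ₂
chain T = record
  { _≤_ = T._≤_
  ; _∨_ = M._⊔_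
  ; isJoinSemilattice = record
    { isPartialOrder = T.isPartialOrder
    ; supremum = λ x y → M.x≤x⊔y x y , M.x≤y⊔x x y , λ _ → M.⊔-lub
    }
  }
  where
  module T = TotalOrder T
  module M = Max T

infixr 2 _⊗_

_⊗_ : JoinSemilattice a ℓ₁ ℓ₂ → JoinSemilattice b ℓ₃ ℓ₄ →
      JoinSemilattice (a ⊔ b) (ℓ₁ ⊔ ℓ₃) (ℓ₂ ⊔ ℓ₄)
L ⊗ M = record
  { _≈_ = Pointwise L._≈_ M._≈_
  ; _≤_ = Pointwise L._≤_ M._≤_
  ; _∨_ = λ (x , u) (y , v) → (x L.∨ y) , (u M.∨ v)
  ; isJoinSemilattice = record
    { isPartialOrder = ×-isPartialOrder L.isPartialOrder M.isPartialOrder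
    ; supremum = λ (x , u) (y , v) →
          (L.x≤x∨y x y , M.x≤x∨y u v)
        , (L.y≤x∨y x y , M.y≤x∨y u v)
        , λ _ (x≤z , u≤w) (y≤z , v≤w) → L.∨-least x≤z y≤z , M.∨-least u≤w v≤w
    }
  }
  where
  module L = JoinSemilattice L
  module M = JoinSemilattice M

subsemilattice : (L : JoinSemilattice a ℓ₁ ℓ₂) (P : Pred (JoinSemilattice.Carrier L) p) →
                 (∀ x y → P x → P y → P (JoinSemilattice._∨_ L x y)) →
                 JoinSemilattice (a ⊔ p) ℓ₁ ℓ₂
subsemilattice L P P-∨ = record
  { Carrier = Σ L.Carrier P
  ; _≈_ = L._≈_ on proj₁
  ; _≤_ = L._≤_ on proj₁
  ; _∨_ = λ (x , px) (y , py) → (x L.∨ y) , P-∨ x y px py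
  ; isJoinSemilattice = record
    { isPartialOrder = On.isPartialOrder proj₁ L.isPartialOrder
    ; supremum = λ (x , _) (y , _) → L.x≤x∨y x y , L.y≤x∨y x y , λ _ → L.∨-least
    }
  }
  where module L = JoinSemilattice L

module _ (L : JoinSemilattice a ℓ₁ ℓ₂) where
  open JoinSemilattice L using (Carrier; _≤_; _∨_; x≤x∨y; y≤x∨y; ∨-least; trans)

  IsSupremum : {I : Set} → (I → Carrier) → Carrier → Set _
  IsSupremum f s = (∀ i → f i ≤ s) × (∀ u → (∀ i → f i ≤ u) → s ≤ u)

  Directed : {I : Set} → (I → Carrier) → Set _
  Directed {I} f = I × (∀ i j → ∃[ k ] f i ≤ f k × f j ≤ f k)

  -- In a complete lattice, such as C B below, this is equivalent to the finite
  -- subcover form: a supremum is the directed supremum of its finite joins.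
  Compact : Pred Carrier _
  Compact x = {I : Set} (f : I → Carrier) → Directed f →
              ∀ s → IsSupremum f s → x ≤ s → ∃[ i ] x ≤ f i

  compact-∨ : ∀ x y → Compact x → Compact y → Compact (x ∨ y)
  compact-∨ x y cx cy f dir s sup x∨y≤s
    with cx f dir s sup (trans (x≤x∨y x y) x∨y≤s)
       | cy f dir s sup (trans (y≤x∨y x y) x∨y≤s)
  ... | i , x≤fi | j , y≤fj with proj₂ dir i j
  ... | k , fi≤fk , fj≤fk = k , ∨-least (trans x≤fi fi≤fk) (trans y≤fj fj≤fk)

  compactElements : JoinSemilattice _ ℓ₁ ℓ₂
  compactElements = subsemilattice L Compact compact-∨

record Bichain : Set₁ where
  infix 4 _≤₁_ _≤₂_
  field
    X     : Set
    _≤₁_  : Rel X 0ℓ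
    _≤₂_  : Rel X 0ℓ
    isTotalOrder₁ : IsTotalOrder _≡_ _≤₁_
    isTotalOrder₂ : IsTotalOrder _≡_ _≤₂_

  chain₁ chain₂ : TotalOrder 0ℓ 0ℓ 0ℓ
  chain₁ = record { isTotalOrder = isTotalOrder₁ }
  chain₂ = record { isTotalOrder = isTotalOrder₂ }

InitialSegment : (T : TotalOrder a ℓ₁ ℓ₂) → Pred (Pred (TotalOrder.Carrier T) ℓ) _
InitialSegment T I = ∀ {x y} → y ≤ x → I x → I y
  where open TotalOrder T

module _ (B : Bichain) where
  open Bichain B
  private
    module ≤₁ = IsTotalOrder isTotalOrder₁
    module ≤₂ = IsTotalOrder isTotalOrder₂

  IsClosed : Pred (Pred X 0ℓ) _
  IsClosed A = Σ[ I₁ ∈ Pred X 0ℓ ] Σ[ I₂ ∈ Pred X 0ℓ ]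
    InitialSegment chain₁ I₁ × InitialSegment chain₂ I₂ × A ≐ (I₁ ∩ I₂)

  -- An explicit form of the least closed set containing S; see closure-isClosed,
  -- ⊆-closure and closure-least.
  closure : Pred X 0ℓ → Pred X 0ℓ
  closure S x = (∃[ y ] S y × x ≤₁ y) × (∃[ z ] S z × x ≤₂ z)

  closure-isClosed : ∀ S → IsClosed (closure S)
  closure-isClosed S =
    (λ x → ∃[ y ] S y × x ≤₁ y) , (λ x → ∃[ z ] S z × x ≤₂ z)
    , (λ x′≤x (y , sy , x≤y) → y , sy , ≤₁.trans x′≤x x≤y)
    , (λ x′≤x (z , sz , x≤z) → z , sz , ≤₂.trans x′≤x x≤z)
    , (λ c → c) , (λ c → c)

  ⊆-closure : ∀ {S} → S ⊆ closure S
  ⊆-closure {_} {x} sx = (x , sx , ≤₁.refl) , (x , sx , ≤₂.refl)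

  closure-least : ∀ {S A} → IsClosed A → S ⊆ A → closure S ⊆ A
  closure-least (_ , _ , init₁ , init₂ , A⊆ , ⊆A) S⊆A ((_ , sy , x≤y) , (_ , sz , x≤z)) =
    ⊆A (init₁ x≤y (proj₁ (A⊆ (S⊆A sy))) , init₂ x≤z (proj₂ (A⊆ (S⊆A sz))))

  -- Closed sets are compared extensionally, by mutual inclusion.
  C : JoinSemilattice (lsuc 0ℓ) 0ℓ 0ℓ
  C = record
    { Carrier = Σ (Pred X 0ℓ) IsClosed
    ; _≈_ = λ (A , _) (A′ , _) → A ≐ A′
    ; _≤_ = λ (A , _) (A′ , _) → A ⊆ A′
    ; _∨_ = λ (A , _) (A′ , _) → closure (A ∪ A′) , closure-isClosed (A ∪ A′)
    ; isJoinSemilattice = record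
      { isPartialOrder = record
        { isPreorder = record
          { isEquivalence = record
            { refl  = (λ c → c) , (λ c → c)
            ; sym   = λ (f , g) → g , f
            ; trans = λ (f , g) (h , k) → (λ c → h (f c)) , (λ c → g (k c))
            }
          ; reflexive = proj₁
          ; trans = λ f g c → g (f c)
          }
        ; antisym = λ f g → f , g
        }
      ; supremum = λ _ _ →
            (λ c → ⊆-closure (inj₁ c))
          , (λ c → ⊆-closure (inj₂ c))
          , λ (_ , closedD) A⊆D A′⊆D →
              closure-least closedD (λ { (inj₁ c) → A⊆D c ; (inj₂ c) → A′⊆D c })
      }
    }

  K : JoinSemilattice (lsuc 0ℓ) 0ℓ 0ℓ
  K = compactElements C

  -- The two lemmas below identify the carrier of K with the closures of finite
  -- subsets of X, so restricting Compact to families indexed by a Set loses nothing.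
  FinitelyGenerated : Pred (JoinSemilattice.Carrier C) _
  FinitelyGenerated (A , _) = Σ[ F ∈ List X ] A ≐ closure (_∈ F)

  compact⇒finitelyGenerated : ∀ {A} → Compact C A → FinitelyGenerated A
  compact⇒finitelyGenerated {A , closedA} compactA =
    let (F , F⊆A) , A⊆ = compactA family directed (A , closedA) isSup (λ c → c)
    in F , A⊆ , closure-least closedA (All.lookup F⊆A)
    where
    family : Σ (List X) (All A) → JoinSemilattice.Carrier C
    family (F , _) = closure (_∈ F) , closure-isClosed (_∈ F)

    mono : ∀ {F G : List X} → (∀ {x} → x ∈ F → x ∈ G) → closure (_∈ F) ⊆ closure (_∈ G)
    mono {_} {G} F⊆G = closure-least (closure-isClosed (_∈ G)) (λ m → ⊆-closure (F⊆G m))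

    directed : Directed C family
    directed = ([] , []) , λ (F , F⊆A) (G , G⊆A) →
      (F ++ G , ++⁺ F⊆A G⊆A) , mono ∈-++⁺ˡ , mono (∈-++⁺ʳ F)

    isSup : IsSupremum C family (A , closedA)
    isSup = (λ (F , F⊆A) → closure-least closedA (All.lookup F⊆A))
          , λ _ ub {x} c → ub (x ∷ [] , c ∷ []) (⊆-closure (here refl))

  finitelyGenerated⇒compact : ∀ {A} → FinitelyGenerated A → Compact C A
  finitelyGenerated⇒compact {A , _} (F , A⊆ , ⊆A) {I} f (i₀ , dir) (S , closedS) (_ , least) A⊆S =
    let i , F⊆fi = bound F (λ m → S⊆U (A⊆S (⊆A (⊆-closure m))))
    in i , λ c → closure-least (proj₂ (f i)) F⊆fi (A⊆ c)
    where
    U : Pred X 0ℓ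
    U x = ∃[ i ] proj₁ (f i) x

    closure-U : closure U ⊆ U
    closure-U ((y , (i , yi) , x≤y) , (z , (j , zj) , x≤z)) with dir i j
    ... | k , fi⊆fk , fj⊆fk =
      let _ , _ , init₁ , init₂ , fk⊆ , ⊆fk = proj₂ (f k)
      in k , ⊆fk (init₁ x≤y (proj₁ (fk⊆ (fi⊆fk yi))) , init₂ x≤z (proj₂ (fk⊆ (fj⊆fk zj))))

    S⊆U : S ⊆ U
    S⊆U c = closure-U (least (closure U , closure-isClosed U) (λ i c → ⊆-closure (i , c)) c)

    bound : (F : List X) → (∀ {x} → x ∈ F → U x) → ∃[ i ] (∀ {x} → x ∈ F → proj₁ (f i) x)
    bound [] _ = i₀ , λ ()
    bound (x ∷ F) F⊆U with F⊆U (here refl) | bound F (λ m → F⊆U (there m))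
    ... | i , xi | j , F⊆fj with dir i j
    ... | k , fi⊆fk , fj⊆fk = k , λ { (here refl) → fi⊆fk xi ; (there m) → fj⊆fk (F⊆fj m) }

HasOrderTypeω : TotalOrder a ℓ₁ ℓ₂ → Set _
HasOrderTypeω T = Σ[ f ∈ (ℕ → Carrier) ] IsOrderIsomorphism _≡_ _≈_ ℕ._≤_ _≤_ f
  where open TotalOrder T

-- Classically this is the negation of being order-scattered; constructively it is
-- the stronger, positive form, with the embedding given.
ContainsCopyOfℚ : TotalOrder a ℓ₁ ℓ₂ → Set _
ContainsCopyOfℚ T = Σ[ f ∈ (ℚ → Carrier) ] IsOrderMonomorphism _≡_ _≈_ ℚ._≤_ _≤_ f
  where open TotalOrder T

𝓛D : JoinSemilattice a ℓ₁ ℓ₂ → Set _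
𝓛D S = Σ[ B ∈ Bichain ]
  HasOrderTypeω (Bichain.chain₁ B) × ContainsCopyOfℚ (Bichain.chain₂ B) × S ≅ K B

IsInteger : Pred ℚ 0ℓ
IsInteger q = Σ[ z ∈ ℤ ] q ≡ z ℚ./ 1

2^_·_ : ℕ → ℚ → ℚ
2^ n · r = (ℤ.+ (2 ℕ.^ n) ℚ./ 1) ℚ.* r

record IsDyadicIn[0,1⟩ (r : ℚ) : Set where
  field
    dyadic : ∃[ k ] IsInteger (2^ k · r)
    0≤r    : 0ℚ ℚ.≤ r
    r<1    : r ℚ.< 1ℚ

D : TotalOrder 0ℓ 0ℓ 0ℓ
D = On.totalOrder (DecTotalOrder.totalOrder ℚ.≤-decTotalOrder) (proj₁ {B = IsDyadicIn[0,1⟩})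

/1-homo-* : ∀ i j → (i ℤ.* j) ℚ./ 1 ≡ (i ℚ./ 1) ℚ.* (j ℚ./ 1)
/1-homo-* i j = ℚ.toℚᵘ-injective (begin
  ℚ.toℚᵘ ((i ℤ.* j) ℚ./ 1)                    ≈⟨ ℚ.toℚᵘ-fromℚᵘ ((i ℤ.* j) ℚᵘ./ 1) ⟩
  (i ℚᵘ./ 1) ℚᵘ.* (j ℚᵘ./ 1)                   ≈⟨ ℚᵘ.*-cong (ℚ.toℚᵘ-fromℚᵘ (i ℚᵘ./ 1)) (ℚ.toℚᵘ-fromℚᵘ (j ℚᵘ./ 1)) ⟨
  ℚ.toℚᵘ (i ℚ./ 1) ℚᵘ.* ℚ.toℚᵘ (j ℚ./ 1)       ≈⟨ ℚ.toℚᵘ-homo-* (i ℚ./ 1) (j ℚ./ 1) ⟨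
  ℚ.toℚᵘ ((i ℚ./ 1) ℚ.* (j ℚ./ 1))             ∎)
  where open ℚᵘ.≃-Reasoning

isInteger-mono : ∀ m n r → m ℕ.≤ n → IsInteger (2^ m · r) → IsInteger (2^ n · r)
isInteger-mono m n r m≤n (z , eq) = ℤ.+ (2 ℕ.^ (n ℕ.∸ m)) ℤ.* z , (begin
  (ℤ.+ (2 ℕ.^ n) ℚ./ 1) ℚ.* r                                    ≡⟨ cong (λ k → (k ℚ./ 1) ℚ.* r) split ⟩
  ((ℤ.+ (2 ℕ.^ (n ℕ.∸ m)) ℤ.* ℤ.+ (2 ℕ.^ m)) ℚ./ 1) ℚ.* r        ≡⟨ cong (ℚ._* r) (/1-homo-* 2ᵏ 2ᵐ) ⟩
  ((2ᵏ ℚ./ 1) ℚ.* (2ᵐ ℚ./ 1)) ℚ.* r                              ≡⟨ ℚ.*-assoc (2ᵏ ℚ./ 1) (2ᵐ ℚ./ 1) r ⟩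
  (2ᵏ ℚ./ 1) ℚ.* (2^ m · r)                                      ≡⟨ cong ((2ᵏ ℚ./ 1) ℚ.*_) eq ⟩
  (2ᵏ ℚ./ 1) ℚ.* (z ℚ./ 1)                                       ≡⟨ /1-homo-* 2ᵏ z ⟨
  (2ᵏ ℤ.* z) ℚ./ 1                                               ∎)
  where
  open ≡-Reasoning
  2ᵏ = ℤ.+ (2 ℕ.^ (n ℕ.∸ m))
  2ᵐ = ℤ.+ (2 ℕ.^ m)
  split : ℤ.+ (2 ℕ.^ n) ≡ 2ᵏ ℤ.* 2ᵐ
  split = ≡.trans (cong ℤ.+_ (≡.trans (cong (2 ℕ.^_) (sym (ℕ.m∸n+n≡m m≤n)))
                                  (ℕ.^-distribˡ-+-* 2 (n ℕ.∸ m) m)))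
                (ℤ.pos-* (2 ℕ.^ (n ℕ.∸ m)) (2 ℕ.^ m))

ℕ×D : JoinSemilattice 0ℓ 0ℓ 0ℓ
ℕ×D = chain ℕ.≤-totalOrder ⊗ chain D

module ℕ×D = JoinSemilattice ℕ×D

InΩ : Pred ℕ×D.Carrier 0ℓ
InΩ (n , r , _) = IsInteger (2^ n · r)

InΩ-∨ : ∀ x y → InΩ x → InΩ y → InΩ (x ℕ×D.∨ y)
InΩ-∨ x@(m , r) y@(n , s) hx hy = helper (Max.⊔-sel D r s)
  where
  m∨n = proj₁ (x ℕ×D.∨ y)
  r∨s = proj₁ (proj₂ (x ℕ×D.∨ y))

  helper : r∨s ≡ proj₁ r ⊎ r∨s ≡ proj₁ s → IsInteger (2^ m∨n · r∨s)
  helper (inj₁ eq) = subst (λ q → IsInteger (2^ m∨n · q)) (sym eq)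
    (isInteger-mono m m∨n (proj₁ r) (proj₁ (ℕ×D.x≤x∨y x y)) hx)
  helper (inj₂ eq) = subst (λ q → IsInteger (2^ m∨n · q)) (sym eq)
    (isInteger-mono n m∨n (proj₁ s) (proj₁ (ℕ×D.y≤x∨y x y)) hy)

Ω[η] : JoinSemilattice 0ℓ 0ℓ 0ℓ
Ω[η] = subsemilattice ℕ×D InΩ InΩ-∨

{-# OPTIONS --safe #-}
module Submission where

-- A nonempty compact element of C(B) is {x | x ≤₁ a, x ≤₂ b} for the ≤₁-greatest a and the
-- ≤₂-greatest b of a finite generating set, and joins are coordinatewise maxima.
--
-- K(C(B)) into Ω(η): if x₀, x₁, … is the ≤₁-increasing enumeration of X, then
-- φ(xₙ) = Σ {2^-(i+1) | i ≤ n, xᵢ ≤₂ xₙ} is strictly ≤₂-increasing and 2ⁿ⁺¹ φ(xₙ) is an integer, so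
-- (xₙ , b) ↦ (n + 1 , φ(b)) works, with (0 , 0) left for the empty set.
--
-- Ω(η) into K(C(B)): let g : ℚ → X embed ℚ in (X , ≤₂), and send (n , r) to the pair (aₙ , g(r)),
-- where aₙ is the image of a negative rational, so that aₙ ≤₂ g(r). Infinitely many such images
-- are available, so aₙ can be chosen ≤₁-above aₙ₋₁ and above g(r) for the
-- finitely many r with 2ⁿ r ∈ ℤ.

open import Defs
open import Relation.Binary.Lattice.Bundles using (JoinSemilattice)

open import Level using (Level; 0ℓ)
import Algebra.Construct.NaturalChoice.Max as Max
import Algebra.Morphism.Construct.Composition as Composition
open import Algebra.Morphism.Structures using (module MagmaMorphisms)
open import Data.Bool.Base using (if_then_else_)
open import Data.Fin.Base using (Fin; toℕ; fromℕ<)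
import Data.Fin.Properties as Fin
open import Data.Integer.Base as ℤ using (+_; -[1+_]; ∣_∣)
import Data.Integer.Properties as ℤ
open import Data.List.Base using (List; []; _∷_; _++_; foldr; map; upTo; cartesianProductWith)
open import Data.List.Extrema.Nat using (max; xs≤max)
open import Data.List.Membership.Propositional using (_∈_)
open import Data.List.Membership.Propositional.Properties
  using (∈-++⁺ˡ; ∈-++⁺ʳ; ∈-++⁻; ∈-map⁺; ∈-upTo⁺; ∈-cartesianProductWith⁺)
import Data.List.Relation.Unary.All as All
open import Data.List.Relation.Unary.Any using (here; there)
open import Data.Nat.Base as ℕ using (ℕ; zero; suc; z≤n; s≤s)
import Data.Nat.Coprimality as Coprimality
open import Data.Nat.Divisibility using (_∣_; divides; ∣⇒≤)
import Data.Nat.Properties as ℕ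
open import Data.Nat.Tactic.RingSolver using (solve-∀)
open import Data.Product.Base using (∃-syntax; _×_; _,_; proj₁; proj₂)
open import Data.Rational.Base as ℚ using (ℚ; mkℚ; 0ℚ)
import Data.Rational.Properties as ℚ
open import Data.Rational.Unnormalised.Base as ℚᵘ using (mkℚᵘ; *≡*; *<*)
import Data.Rational.Unnormalised.Properties as ℚᵘ
open import Data.Sum.Base using (_⊎_; inj₁; inj₂; [_,_]′)
open import Function.Base using (_∘_; id; case_of_)
open import Function.Definitions using (Injective)
open import Relation.Binary.Bundles using (Poset; TotalOrder)
open import Relation.Binary.Consequences using (total∧dec⇒dec)
open import Relation.Binary.Core using (Rel)
open import Relation.Binary.Lattice.Properties.JoinSemilattice using (∨-cong)
open import Relation.Binary.Morphism.Structures using (module IsOrderIsomorphism; module IsOrderMonomorphism)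
open import Relation.Binary.PropositionalEquality
  using (_≡_; refl; sym; trans; cong; subst; subst₂; isEquivalence; module ≡-Reasoning)
import Relation.Binary.Reasoning.Setoid as SetoidReasoning
open import Relation.Binary.Structures using (IsTotalOrder)
open import Relation.Nullary using (¬_; Dec; yes; no; does; contradiction)
open import Relation.Nullary.Decidable using (decidable-stable)
open import Relation.Unary using (Pred)

private
  variable
    a b c p ℓ₁ ℓ₂ ℓ₃ ℓ₄ ℓ₅ ℓ₆ : Level

-- Composing embeddings and inverting isomorphisms.

↪-trans : {L : JoinSemilattice a ℓ₁ ℓ₂} {M : JoinSemilattice b ℓ₃ ℓ₄} {N : JoinSemilattice c ℓ₅ ℓ₆} →
          L ↪ M → M ↪ N → L ↪ N
↪-trans {N = N} (f , f-mono) (g , g-mono) =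
  g ∘ f , Composition.isMagmaMonomorphism (JoinSemilattice.Eq.trans N) f-mono g-mono

module _ {L : JoinSemilattice a ℓ₁ ℓ₂} {M : JoinSemilattice b ℓ₃ ℓ₄} where
  private
    module L = JoinSemilattice L
    module M = JoinSemilattice M

  ≅⇒↪ : L ≅ M → L ↪ M
  ≅⇒↪ (f , f-iso) = f , isMagmaMonomorphism
    where open MagmaMorphisms.IsMagmaIsomorphism f-iso

  -- Surjectivity supplies a section `g` of `f`. Injectivity of `f` carries congruence and
  -- preservation of joins over to `g`, and congruence of `f` makes `g` injective.
  ≅⇒↩ : L ≅ M → M ↪ L
  ≅⇒↩ (f , f-iso) = g , record
    { isMagmaHomomorphism = record
      { isRelHomomorphism = record
        { cong = λ {x} {y} x≈y → injective (M.Eq.trans (fg x) (M.Eq.trans x≈y (M.Eq.sym (fg y)))) }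
      ; homo = λ x y → injective (M.Eq.trans (fg (x M.∨ y)) (M.Eq.trans
          (∨-cong M (M.Eq.sym (fg x)) (M.Eq.sym (fg y))) (M.Eq.sym (homo (g x) (g y)))))
      }
    ; injective = λ {x} {y} gx≈gy →
        M.Eq.trans (M.Eq.sym (fg x)) (M.Eq.trans (⟦⟧-cong gx≈gy) (fg y))
    }
    where
    open MagmaMorphisms.IsMagmaIsomorphism f-iso
    g : M.Carrier → L.Carrier
    g y = proj₁ (surjective y)
    fg : ∀ y → f (g y) M.≈ y
    fg y = proj₂ (surjective y) L.Eq.refl

∨-prime : (T : TotalOrder a ℓ₁ ℓ₂) → let module T = TotalOrder T in
          ∀ {t} u v → t T.≤ JoinSemilattice._∨_ (chain T) u v → t T.≤ u ⊎ t T.≤ v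
∨-prime T u v t≤u∨v with Max.⊔-sel T u v
... | inj₁ u∨v≈u = inj₁ (TotalOrder.trans T t≤u∨v (TotalOrder.reflexive T u∨v≈u))
... | inj₂ u∨v≈v = inj₂ (TotalOrder.trans T t≤u∨v (TotalOrder.reflexive T u∨v≈v))

-- Joins of finite families.

module FiniteJoins
  (L : JoinSemilattice a ℓ₁ ℓ₂) (⊥ : JoinSemilattice.Carrier L)
  (⊥-min : ∀ u → JoinSemilattice._≤_ L ⊥ u)
  {X : Set} (e : X → JoinSemilattice.Carrier L) where

  open JoinSemilattice L using (Carrier; _≈_; _≤_; _∨_; x≤x∨y; y≤x∨y; ∨-least; antisym)
    renaming (trans to ≤-trans)

  ⋁ : List X → Carrier
  ⋁ = foldr (λ x u → e x ∨ u) ⊥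

  ≤⋁ : ∀ {F x} → x ∈ F → e x ≤ ⋁ F
  ≤⋁ {x ∷ F} (here refl) = x≤x∨y (e x) (⋁ F)
  ≤⋁ {y ∷ F} (there x∈F) = ≤-trans (≤⋁ x∈F) (y≤x∨y (e y) (⋁ F))

  ⋁-least : ∀ F {u} → (∀ {x} → x ∈ F → e x ≤ u) → ⋁ F ≤ u
  ⋁-least []      F≤u = ⊥-min _
  ⋁-least (x ∷ F) F≤u = ∨-least (F≤u (here refl)) (⋁-least F (F≤u ∘ there))

  ⋁-++ : ∀ F G → ⋁ (F ++ G) ≈ ⋁ F ∨ ⋁ G
  ⋁-++ F G = antisym
    (⋁-least (F ++ G) ([ (λ m → ≤-trans (≤⋁ m) (x≤x∨y (⋁ F) (⋁ G)))
                       , (λ m → ≤-trans (≤⋁ m) (y≤x∨y (⋁ F) (⋁ G))) ]′ ∘ ∈-++⁻ F))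
    (∨-least (⋁-least F (≤⋁ ∘ ∈-++⁺ˡ)) (⋁-least G (≤⋁ ∘ ∈-++⁺ʳ F)))

  -- Used with `P` a lower bound on a single coordinate: in a chain a maximum equals one of its
  -- arguments, so the bound is attained at one entry of the list. The order of the product itself
  -- is not prime in this sense, so the two coordinates are treated separately.
  ⋁-prime : {P : Pred Carrier p} → (∀ u v → P (u ∨ v) → P u ⊎ P v) → ¬ P ⊥ →
            ∀ F → P (⋁ F) → ∃[ x ] x ∈ F × P (e x)
  ⋁-prime prime ¬P⊥ []      P⊥ = contradiction P⊥ ¬P⊥
  ⋁-prime prime ¬P⊥ (x ∷ F) P∨ with prime (e x) (⋁ F) P∨
  ... | inj₁ Pe = x , here refl , Pe
  ... | inj₂ P⋁ with ⋁-prime prime ¬P⊥ F P⋁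
  ... | y , y∈F , Pe = y , there y∈F , Pe

-- Fractions, and the dyadic rationals of bounded level.

toℚᵘ-/ : ∀ z d .{{_ : ℕ.NonZero d}} → ℚ.toℚᵘ (z ℚ./ d) ℚᵘ.≃ z ℚᵘ./ d
toℚᵘ-/ z (suc d) = ℚ.toℚᵘ-fromℚᵘ (mkℚᵘ z d)

/-mono-< : ∀ m n d e .{{_ : ℕ.NonZero d}} .{{_ : ℕ.NonZero e}} →
           m ℕ.* e ℕ.< n ℕ.* d → + m ℚ./ d ℚ.< + n ℚ./ e
/-mono-< m n d@(suc _) e@(suc _) me<nd = ℚ.toℚᵘ-cancel-<
  (ℚᵘ.<-respˡ-≃ (ℚᵘ.≃-sym (toℚᵘ-/ (+ m) d)) (ℚᵘ.<-respʳ-≃ (ℚᵘ.≃-sym (toℚᵘ-/ (+ n) e))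
    (*<* (subst₂ ℤ._<_ (ℤ.pos-* m e) (ℤ.pos-* n d) (ℤ.+<+ me<nd)))))

d*[z/d]≡z : ∀ z d .{{_ : ℕ.NonZero d}} → (+ d ℚ./ 1) ℚ.* (z ℚ./ d) ≡ z ℚ./ 1
d*[z/d]≡z z d@(suc _) = ℚ.toℚᵘ-injective (begin
  ℚ.toℚᵘ ((+ d ℚ./ 1) ℚ.* (z ℚ./ d))           ≈⟨ ℚ.toℚᵘ-homo-* (+ d ℚ./ 1) (z ℚ./ d) ⟩
  ℚ.toℚᵘ (+ d ℚ./ 1) ℚᵘ.* ℚ.toℚᵘ (z ℚ./ d)      ≈⟨ ℚᵘ.*-cong (toℚᵘ-/ (+ d) 1) (toℚᵘ-/ z d) ⟩
  (+ d ℚᵘ./ 1) ℚᵘ.* (z ℚᵘ./ d)                  ≈⟨ *≡* eq ⟩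
  z ℚᵘ./ 1                                      ≈⟨ toℚᵘ-/ z 1 ⟨
  ℚ.toℚᵘ (z ℚ./ 1)                              ∎)
  where
  open ℚᵘ.≃-Reasoning
  eq : (+ d ℤ.* z) ℤ.* + 1 ≡ z ℤ.* + (1 ℕ.* d)
  eq = trans (ℤ.*-identityʳ (+ d ℤ.* z)) (trans (ℤ.*-comm (+ d) z)
         (cong (λ k → z ℤ.* + k) (sym (ℕ.*-identityˡ d))))

-- A crude finite superset of the `r` allowed at a given level: it also contains fractions that are
-- not dyadic, which is harmless for an upper bound.
fractions : ℕ → List ℚ
fractions N = cartesianProductWith (λ d j → + j ℚ./ suc d) (upTo N) (upTo N)

-- Write `r` as j/d in lowest terms. Since 2ⁿ r is an integer, d divides j 2ⁿ, hence by coprimality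
-- d divides 2ⁿ, so d ≤ 2ⁿ; and j < d because r < 1.
∈-fractions : ∀ n {r} → IsDyadicIn[0,1⟩ r → IsInteger (2^ n · r) → r ∈ fractions (2 ℕ.^ n)
∈-fractions n {mkℚ -[1+ _ ] _ _} dyadic _ with IsDyadicIn[0,1⟩.0≤r dyadic
... | ℚ.*≤* ()
∈-fractions n {r@(mkℚ (+ j) d-1 coprime)} dyadic (z , 2ⁿr≡z) =
  subst (_∈ fractions (2 ℕ.^ n)) (ℚ.↥p/↧p≡p r)
    (∈-cartesianProductWith⁺ (λ d j → + j ℚ./ suc d) (∈-upTo⁺ d≤2ⁿ) (∈-upTo⁺ (ℕ.<-≤-trans j<d d≤2ⁿ)))
  where
  d = suc d-1

  j<d : j ℕ.< d
  j<d with IsDyadicIn[0,1⟩.r<1 dyadic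
  ... | ℚ.*<* lt = ℤ.drop‿+<+ (subst₂ ℤ._<_ (ℤ.*-identityʳ (+ j)) (ℤ.*-identityˡ (+ d)) lt)

  cross : (+ (2 ℕ.^ n) ℚᵘ./ 1) ℚᵘ.* mkℚᵘ (+ j) d-1 ℚᵘ.≃ z ℚᵘ./ 1
  cross = begin
    (+ (2 ℕ.^ n) ℚᵘ./ 1) ℚᵘ.* ℚ.toℚᵘ r             ≈⟨ ℚᵘ.*-congʳ {ℚ.toℚᵘ r} (toℚᵘ-/ (+ (2 ℕ.^ n)) 1) ⟨
    ℚ.toℚᵘ (+ (2 ℕ.^ n) ℚ./ 1) ℚᵘ.* ℚ.toℚᵘ r       ≈⟨ ℚ.toℚᵘ-homo-* (+ (2 ℕ.^ n) ℚ./ 1) r ⟨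
    ℚ.toℚᵘ (2^ n · r)                              ≡⟨ cong ℚ.toℚᵘ 2ⁿr≡z ⟩
    ℚ.toℚᵘ (z ℚ./ 1)                               ≈⟨ toℚᵘ-/ z 1 ⟩
    z ℚᵘ./ 1                                       ∎
    where open ℚᵘ.≃-Reasoning

  divisibility : d ∣ j ℕ.* 2 ℕ.^ n
  divisibility with cross
  ... | *≡* eq = divides ∣ z ∣ (begin
    j ℕ.* 2 ℕ.^ n                        ≡⟨ ℕ.*-comm j (2 ℕ.^ n) ⟩
    ∣ + (2 ℕ.^ n) ∣ ℕ.* j                ≡⟨ ℤ.abs-* (+ (2 ℕ.^ n)) (+ j) ⟨
    ∣ + (2 ℕ.^ n) ℤ.* + j ∣              ≡⟨ cong ∣_∣ (ℤ.*-identityʳ (+ (2 ℕ.^ n) ℤ.* + j)) ⟨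
    ∣ + (2 ℕ.^ n) ℤ.* + j ℤ.* + 1 ∣      ≡⟨ cong ∣_∣ eq ⟩
    ∣ z ℤ.* + (1 ℕ.* d) ∣                ≡⟨ ℤ.abs-* z (+ (1 ℕ.* d)) ⟩
    ∣ z ∣ ℕ.* (1 ℕ.* d)                  ≡⟨ cong (∣ z ∣ ℕ.*_) (ℕ.*-identityˡ d) ⟩
    ∣ z ∣ ℕ.* d                          ∎)
    where open ≡-Reasoning

  d≤2ⁿ : d ℕ.≤ 2 ℕ.^ n
  d≤2ⁿ = ∣⇒≤ {{ℕ.m^n≢0 2 n}}
    (Coprimality.coprime-divisor (Coprimality.sym (Coprimality.recompute coprime)) divisibility)

-- A linear order on ℕ represented in the dyadic rationals.

module DyadicRepresentation
  (_≼_ : Rel ℕ 0ℓ) (≼-isTotalOrder : IsTotalOrder _≡_ _≼_) where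

  private
    module ≼ = IsTotalOrder ≼-isTotalOrder

  -- A total order is decidable once equality is, so the digits can be computed.
  _≼?_ : ∀ m n → Dec (m ≼ n)
  _≼?_ = total∧dec⇒dec ≼.reflexive ≼.antisym ≼.total ℕ._≟_

  digit : ℕ → ℕ → ℕ
  digit i n = if does (i ≼? n) then 1 else 0

  digit-≼ : ∀ {i n} → i ≼ n → digit i n ≡ 1
  digit-≼ {i} {n} i≼n with i ≼? n
  ... | yes _  = refl
  ... | no i⋠n = contradiction i≼n i⋠n

  digit-⋠ : ∀ {i n} → ¬ i ≼ n → digit i n ≡ 0
  digit-⋠ {i} {n} i⋠n with i ≼? n
  ... | yes i≼n = contradiction i≼n i⋠n
  ... | no _    = refl

  digit≤1 : ∀ i n → digit i n ℕ.≤ 1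
  digit≤1 i n with i ≼? n
  ... | yes _ = s≤s z≤n
  ... | no _  = z≤n

  digit-mono : ∀ i {m n} → m ≼ n → digit i m ℕ.≤ digit i n
  digit-mono i {m} {n} m≼n with i ≼? m
  ... | no _    = z≤n
  ... | yes i≼m = ℕ.≤-reflexive (sym (digit-≼ (≼.trans i≼m m≼n)))

  -- The number with binary digits [0 ≼ n], …, [k - 1 ≼ n], most significant first.
  binary : ℕ → ℕ → ℕ
  binary zero    n = 0
  binary (suc k) n = digit k n ℕ.+ 2 ℕ.* binary k n

  binary-mono : ∀ k {m n} → m ≼ n → binary k m ℕ.≤ binary k n
  binary-mono zero    m≼n = z≤n
  binary-mono (suc k) m≼n = ℕ.+-mono-≤ (digit-mono k m≼n) (ℕ.*-monoʳ-≤ 2 (binary-mono k m≼n))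

  -- Appending `j` digits multiplies by 2ʲ and adds at least 0 and at most 2ʲ - 1. This is the lower
  -- bound; `binary-upper` is the upper one.
  binary-lower : ∀ j k n → 2 ℕ.^ j ℕ.* binary k n ℕ.≤ binary (j ℕ.+ k) n
  binary-lower zero    k n = ℕ.≤-reflexive (ℕ.*-identityˡ (binary k n))
  binary-lower (suc j) k n = begin
    2 ℕ.* 2 ℕ.^ j ℕ.* binary k n          ≡⟨ ℕ.*-assoc 2 (2 ℕ.^ j) (binary k n) ⟩
    2 ℕ.* (2 ℕ.^ j ℕ.* binary k n)        ≤⟨ ℕ.*-monoʳ-≤ 2 (binary-lower j k n) ⟩
    2 ℕ.* binary (j ℕ.+ k) n              ≤⟨ ℕ.m≤n+m _ (digit (j ℕ.+ k) n) ⟩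
    binary (suc j ℕ.+ k) n                ∎
    where open ℕ.≤-Reasoning

  binary-upper : ∀ j k n → binary (j ℕ.+ k) n ℕ.< 2 ℕ.^ j ℕ.* suc (binary k n)
  binary-upper zero    k n = ℕ.≤-reflexive (sym (ℕ.*-identityˡ (suc (binary k n))))
  binary-upper (suc j) k n = begin-strict
    digit (j ℕ.+ k) n ℕ.+ 2 ℕ.* binary (j ℕ.+ k) n  ≤⟨ ℕ.+-monoˡ-≤ _ (digit≤1 (j ℕ.+ k) n) ⟩
    1 ℕ.+ 2 ℕ.* binary (j ℕ.+ k) n                  <⟨ ℕ.n<1+n _ ⟩
    2 ℕ.+ 2 ℕ.* binary (j ℕ.+ k) n                  ≡⟨ ℕ.*-suc 2 (binary (j ℕ.+ k) n) ⟨
    2 ℕ.* suc (binary (j ℕ.+ k) n)                  ≤⟨ ℕ.*-monoʳ-≤ 2 (binary-upper j k n) ⟩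
    2 ℕ.* (2 ℕ.^ j ℕ.* suc (binary k n))            ≡⟨ ℕ.*-assoc 2 (2 ℕ.^ j) (suc (binary k n)) ⟨
    2 ℕ.* 2 ℕ.^ j ℕ.* suc (binary k n)              ∎
    where open ℕ.≤-Reasoning

  numerator : ℕ → ℕ
  numerator n = binary (suc n) n

  -- The last digit is [n ≼ n] = 1.
  numerator-odd : ∀ n → numerator n ≡ 1 ℕ.+ 2 ℕ.* binary n n
  numerator-odd n = cong (ℕ._+ 2 ℕ.* binary n n) (digit-≼ ≼.refl)

  numerator<2^ : ∀ n → numerator n ℕ.< 2 ℕ.^ suc n
  numerator<2^ n = subst₂ ℕ._<_ (cong (λ k → binary k n) (ℕ.+-identityʳ (suc n)))
    (ℕ.*-identityʳ (2 ℕ.^ suc n)) (binary-upper (suc n) 0 n)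

  -- The first `n` digits for `m` form a number at most that for `n`, and the digit at position `n`
  -- is 0 for `m` but 1 for `n`.
  binary<numerator : ∀ {m n} → m ≼ n → ¬ n ≼ m → binary (suc n) m ℕ.< numerator n
  binary<numerator {m} {n} m≼n n⋠m = begin-strict
    digit n m ℕ.+ 2 ℕ.* binary n m    ≡⟨ cong (ℕ._+ 2 ℕ.* binary n m) (digit-⋠ n⋠m) ⟩
    2 ℕ.* binary n m                  ≤⟨ ℕ.*-monoʳ-≤ 2 (binary-mono n m≼n) ⟩
    2 ℕ.* binary n n                  <⟨ ℕ.n<1+n _ ⟩
    1 ℕ.+ 2 ℕ.* binary n n            ≡⟨ numerator-odd n ⟨
    numerator n                       ∎
    where open ℕ.≤-Reasoning

  -- This is φ(m) < φ(n) with denominators cleared. Both expansions are compared up to position `n`.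
  -- If m < n, extending the expansion of `m` to that position can only increase it; if n < m, the
  -- digits of `m` after position `n` are worth less than one unit there.
  numerator-< : ∀ {m n} → m ≼ n → ¬ n ≼ m →
                numerator m ℕ.* 2 ℕ.^ suc n ℕ.< numerator n ℕ.* 2 ℕ.^ suc m
  numerator-< {m} {n} m≼n n⋠m with ℕ.≤-total m n
  ... | inj₁ m≤n with ℕ.m≤n⇒m<n∨m≡n m≤n
  ...   | inj₂ refl = contradiction m≼n n⋠m
  ...   | inj₁ m<n  = helper (ℕ.m≤n⇒∃[o]m+o≡n m<n)
    where
    helper : ∃[ o ] suc m ℕ.+ o ≡ n → numerator m ℕ.* 2 ℕ.^ suc n ℕ.< numerator n ℕ.* 2 ℕ.^ suc m
    helper (o , eq) = begin-strict
      numerator m ℕ.* 2 ℕ.^ suc n                     ≡⟨ cong (λ k → numerator m ℕ.* 2 ℕ.^ suc k) n≡ ⟩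
      -- One factor 2 is kept apart to make room for the digit at position `n`.
      numerator m ℕ.* (2 ℕ.* 2 ℕ.^ (o ℕ.+ suc m))     ≡⟨ cong (λ k → numerator m ℕ.* (2 ℕ.* k)) (ℕ.^-distribˡ-+-* 2 o (suc m)) ⟩
      numerator m ℕ.* (2 ℕ.* (2 ℕ.^ o ℕ.* 2 ℕ.^ suc m)) ≡⟨ rearrange (numerator m) (2 ℕ.^ o) (2 ℕ.^ suc m) ⟩
      2 ℕ.* (2 ℕ.^ o ℕ.* numerator m) ℕ.* 2 ℕ.^ suc m ≤⟨ ℕ.*-monoˡ-≤ (2 ℕ.^ suc m) (ℕ.*-monoʳ-≤ 2 (binary-lower o (suc m) m)) ⟩
      2 ℕ.* binary (o ℕ.+ suc m) m ℕ.* 2 ℕ.^ suc m    ≡⟨ cong (λ k → 2 ℕ.* binary k m ℕ.* 2 ℕ.^ suc m) n≡ ⟨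
      2 ℕ.* binary n m ℕ.* 2 ℕ.^ suc m                ≤⟨ ℕ.*-monoˡ-≤ (2 ℕ.^ suc m) (ℕ.m≤n+m _ (digit n m)) ⟩
      binary (suc n) m ℕ.* 2 ℕ.^ suc m                <⟨ ℕ.*-monoˡ-< (2 ℕ.^ suc m) {{ℕ.m^n≢0 2 (suc m)}} (binary<numerator m≼n n⋠m) ⟩
      numerator n ℕ.* 2 ℕ.^ suc m                     ∎
      where
      open ℕ.≤-Reasoning
      n≡ : n ≡ o ℕ.+ suc m
      n≡ = trans (sym eq) (ℕ.+-comm (suc m) o)
      rearrange : ∀ x y z → x ℕ.* (2 ℕ.* (y ℕ.* z)) ≡ 2 ℕ.* (y ℕ.* x) ℕ.* z
      rearrange = solve-∀
  numerator-< {m} {n} m≼n n⋠m | inj₂ n≤m = helper (ℕ.m≤n⇒∃[o]m+o≡n n≤m)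
    where
    helper : ∃[ o ] n ℕ.+ o ≡ m → numerator m ℕ.* 2 ℕ.^ suc n ℕ.< numerator n ℕ.* 2 ℕ.^ suc m
    helper (o , eq) = begin-strict
      numerator m ℕ.* 2 ℕ.^ suc n                           ≡⟨ cong (λ k → binary k m ℕ.* 2 ℕ.^ suc n) m≡ ⟩
      binary (o ℕ.+ suc n) m ℕ.* 2 ℕ.^ suc n                <⟨ ℕ.*-monoˡ-< (2 ℕ.^ suc n) {{ℕ.m^n≢0 2 (suc n)}} (binary-upper o (suc n) m) ⟩
      -- The strict inequality of integers leaves a gap of a whole unit, which absorbs the discarded
      -- digits.
      2 ℕ.^ o ℕ.* suc (binary (suc n) m) ℕ.* 2 ℕ.^ suc n    ≤⟨ ℕ.*-monoˡ-≤ (2 ℕ.^ suc n) (ℕ.*-monoʳ-≤ (2 ℕ.^ o) (binary<numerator m≼n n⋠m)) ⟩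
      2 ℕ.^ o ℕ.* numerator n ℕ.* 2 ℕ.^ suc n               ≡⟨ cong (ℕ._* 2 ℕ.^ suc n) (ℕ.*-comm (2 ℕ.^ o) (numerator n)) ⟩
      numerator n ℕ.* 2 ℕ.^ o ℕ.* 2 ℕ.^ suc n               ≡⟨ ℕ.*-assoc (numerator n) (2 ℕ.^ o) (2 ℕ.^ suc n) ⟩
      numerator n ℕ.* (2 ℕ.^ o ℕ.* 2 ℕ.^ suc n)             ≡⟨ cong (numerator n ℕ.*_) (ℕ.^-distribˡ-+-* 2 o (suc n)) ⟨
      numerator n ℕ.* 2 ℕ.^ (o ℕ.+ suc n)                   ≡⟨ cong (λ k → numerator n ℕ.* 2 ℕ.^ k) m≡ ⟨
      numerator n ℕ.* 2 ℕ.^ suc m                           ∎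
      where
      open ℕ.≤-Reasoning
      m≡ : suc m ≡ o ℕ.+ suc n
      m≡ = trans (cong suc (sym eq)) (ℕ.+-comm (suc n) o)

  φ : ℕ → ℚ
  φ n = (+ numerator n ℚ./ 2 ℕ.^ suc n) {{ℕ.m^n≢0 2 (suc n)}}

  φ-mono-< : ∀ {m n} → m ≼ n → ¬ n ≼ m → φ m ℚ.< φ n
  φ-mono-< {m} {n} m≼n n⋠m = /-mono-< (numerator m) (numerator n) (2 ℕ.^ suc m) (2 ℕ.^ suc n)
    {{ℕ.m^n≢0 2 (suc m)}} {{ℕ.m^n≢0 2 (suc n)}} (numerator-< m≼n n⋠m)

  φ-mono-≤ : ∀ {m n} → m ≼ n → φ m ℚ.≤ φ n
  φ-mono-≤ {m} {n} m≼n = case n ≼? m of λ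
    { (yes n≼m) → ℚ.≤-reflexive (cong φ (≼.antisym m≼n n≼m))
    ; (no n⋠m)  → ℚ.<⇒≤ (φ-mono-< m≼n n⋠m)
    }

  -- The contrapositive of strict monotonicity; decidability of `≼` removes the double negation.
  φ-cancel-≤ : ∀ {m n} → φ m ℚ.≤ φ n → m ≼ n
  φ-cancel-≤ {m} {n} φm≤φn = decidable-stable (m ≼? n) λ m⋠n →
    let n≼m = [ (λ m≼n → contradiction m≼n m⋠n) , id ]′ (≼.total m n)
    in ℚ.<-irrefl refl (ℚ.≤-<-trans φm≤φn (φ-mono-< n≼m m⋠n))

  φ-integer : ∀ n → IsInteger (2^ suc n · φ n)
  φ-integer n = + numerator n , d*[z/d]≡z (+ numerator n) (2 ℕ.^ suc n) {{ℕ.m^n≢0 2 (suc n)}}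

  -- An odd numerator is nonzero. Strictness keeps the value 0 for the empty join.
  φ-positive : ∀ n → 0ℚ ℚ.< φ n
  φ-positive n = /-mono-< 0 (numerator n) 1 (2 ℕ.^ suc n) {{_}} {{ℕ.m^n≢0 2 (suc n)}}
    (subst (0 ℕ.<_) (trans (sym (numerator-odd n)) (sym (ℕ.*-identityʳ (numerator n)))) ℕ.z<s)

  φ-dyadic : ∀ n → IsDyadicIn[0,1⟩ (φ n)
  φ-dyadic n = record
    { dyadic = suc n , φ-integer n
    ; 0≤r    = ℚ.<⇒≤ (φ-positive n)
    ; r<1    = /-mono-< (numerator n) 1 (2 ℕ.^ suc n) 1 {{ℕ.m^n≢0 2 (suc n)}}
        (subst₂ ℕ._<_ (sym (ℕ.*-identityʳ (numerator n))) (sym (ℕ.*-identityˡ (2 ℕ.^ suc n))) (numerator<2^ n))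
    }

-- Negative rationals with arbitrarily late images.

injective⇒unbounded : (f : ℕ → ℕ) → Injective _≡_ _≡_ f → ∀ k → ∃[ i ] k ℕ.≤ f i
injective⇒unbounded f f-injective k with Fin.any? {n = suc k} (λ i → k ℕ.≤? f (toℕ i))
... | yes (i , k≤fi) = toℕ i , k≤fi
-- Pigeonhole: if 0, ..., k all had values below `k`, then `f` would inject k + 1 elements into k.
... | no ¬any        = contradiction (Fin.injective⇒≤ g-injective) (ℕ.<⇒≱ (ℕ.n<1+n k))
  where
  f<k : ∀ i → f (toℕ i) ℕ.< k
  f<k i = ℕ.≰⇒> (λ k≤fi → ¬any (i , k≤fi))

  g : Fin (suc k) → Fin k
  g i = fromℕ< (f<k i)

  g-injective : Injective _≡_ _≡_ g
  g-injective {i} {j} gi≡gj = Fin.toℕ-injective (f-injective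
    (trans (sym (Fin.toℕ-fromℕ< (f<k i))) (trans (cong toℕ gi≡gj) (Fin.toℕ-fromℕ< (f<k j)))))

negative : ℕ → ℚ
negative i = mkℚ -[1+ i ] 0 (Coprimality.sym (Coprimality.1-coprimeTo (suc i)))

negative-injective : Injective _≡_ _≡_ negative
negative-injective eq = ℤ.-[1+-injective (cong ℚ.numerator eq)

-- The embedding of K(C(B)) into Ω(η).

module _ (B : Bichain) (ω : HasOrderTypeω (Bichain.chain₁ B)) where
  open Bichain B

  private
    module ≤₁ = IsTotalOrder isTotalOrder₁
    module ≤₂ = IsTotalOrder isTotalOrder₂
    module C = JoinSemilattice (C B)
    module K = JoinSemilattice (K B)
    module Ω = JoinSemilattice Ω[η]

    seq = proj₁ ω
    module ω = IsOrderIsomorphism (proj₂ ω)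

  index : X → ℕ
  index x = proj₁ (ω.surjective x)

  seq-index : ∀ x → seq (index x) ≡ x
  seq-index x = proj₂ (ω.surjective x) refl

  index-mono : ∀ {x y} → x ≤₁ y → index x ℕ.≤ index y
  index-mono {x} {y} x≤y = ω.cancel (subst₂ _≤₁_ (sym (seq-index x)) (sym (seq-index y)) x≤y)

  index-cancel : ∀ {x y} → index x ℕ.≤ index y → x ≤₁ y
  index-cancel {x} {y} ix≤iy = subst₂ _≤₁_ (seq-index x) (seq-index y) (ω.mono ix≤iy)

  index-injective : Injective _≡_ _≡_ index
  index-injective {x} {y} eq = trans (sym (seq-index x)) (trans (cong seq eq) (seq-index y))

  -- The second order, carried to ℕ along the enumeration; antisymmetry rests on the injectivity of
  -- the latter.
  ≼-isTotalOrder : IsTotalOrder _≡_ (λ m n → seq m ≤₂ seq n)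
  ≼-isTotalOrder = record
    { isPartialOrder = record
      { isPreorder = record
        { isEquivalence = isEquivalence
        ; reflexive = λ { refl → ≤₂.refl }
        ; trans = ≤₂.trans
        }
      ; antisym = λ m≼n n≼m → ω.injective (≤₂.antisym m≼n n≼m)
      }
    ; total = λ m n → ≤₂.total (seq m) (seq n)
    }

  open DyadicRepresentation (λ m n → seq m ≤₂ seq n) ≼-isTotalOrder using
    (φ; φ-mono-≤; φ-cancel-≤; φ-integer; φ-positive; φ-dyadic)

  ⊥Ω : Ω.Carrier
  ⊥Ω = (0 , 0ℚ , record { dyadic = 0 , + 0 , refl ; 0≤r = ℚ.≤-refl ; r<1 = ℚ.*<* (ℤ.+<+ ℕ.z<s) }) , + 0 , refl

  ⊥Ω-min : ∀ u → ⊥Ω Ω.≤ u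
  ⊥Ω-min ((_ , _ , d) , _) = z≤n , IsDyadicIn[0,1⟩.0≤r d

  -- The successor serves twice: `φ n` has denominator 2ⁿ⁺¹, and the first coordinate exceeds that
  -- of `⊥Ω`.
  point : X → Ω.Carrier
  point x = (suc (index x) , φ (index x) , φ-dyadic (index x)) , φ-integer (index x)

  open FiniteJoins Ω[η] ⊥Ω ⊥Ω-min point

  generate : List X → C.Carrier
  generate F = closure B (_∈ F) , closure-isClosed B (_∈ F)

  -- Membership in a closure gives one generator above `x` in each order, and each bounds one
  -- coordinate. With `⋁-cancel`, this shows that the join depends only on the closed set and
  -- determines it.
  ⋁-mono : ∀ F G → generate F C.≤ generate G → ⋁ F Ω.≤ ⋁ G
  ⋁-mono F G F≤G = ⋁-least F {⋁ G} λ {x} x∈F →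
    let (y , y∈G , x≤y) , (z , z∈G , x≤z) = F≤G (⊆-closure B {_∈ F} x∈F)
    in ℕ.≤-trans (s≤s (index-mono x≤y)) (proj₁ (≤⋁ y∈G))
     , ℚ.≤-trans (φ-mono-≤ (subst₂ _≤₂_ (sym (seq-index x)) (sym (seq-index z)) x≤z)) (proj₂ (≤⋁ z∈G))

  -- Each coordinate of `point x` is bounded by that of a single generator. The generators `y` and
  -- `z` may differ, which is just what the closure allows.
  ⋁-cancel : ∀ F G → ⋁ F Ω.≤ ⋁ G → generate F C.≤ generate G
  ⋁-cancel F G F≤G = closure-least B (closure-isClosed B (_∈ G)) λ {x} x∈F →
    let x≤G = Ω.trans {point x} {⋁ F} {⋁ G} (≤⋁ x∈F) F≤G
        (y , y∈G , x≤y) = ⋁-prime {P = λ u → suc (index x) ℕ.≤ proj₁ (proj₁ u)}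
          -- `⊥Ω` fails this predicate because of the successor in `point`, and the next one by
          -- positivity of `φ`.
          (λ u v → ∨-prime ℕ.≤-totalOrder (proj₁ (proj₁ u)) (proj₁ (proj₁ v))) (λ ()) G (proj₁ x≤G)
        (z , z∈G , x≤z) = ⋁-prime {P = λ u → φ (index x) ℚ.≤ proj₁ (proj₂ (proj₁ u))}
          (λ u v → ∨-prime D {φ (index x) , φ-dyadic (index x)} (proj₂ (proj₁ u)) (proj₂ (proj₁ v)))
          (λ φ≤0 → ℚ.<-irrefl refl (ℚ.<-≤-trans (φ-positive (index x)) φ≤0)) G (proj₂ x≤G)
    in (y , y∈G , index-cancel (ℕ.s≤s⁻¹ x≤y))
     , (z , z∈G , subst₂ _≤₂_ (seq-index x) (seq-index z) (φ-cancel-≤ x≤z))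

  generate-++ : ∀ F G → generate (F ++ G) C.≈ generate F C.∨ generate G
  generate-++ F G = C.antisym
    {generate (F ++ G)} {generate F C.∨ generate G}
    (closure-least B (proj₂ (generate F C.∨ generate G))
      ([ C.x≤x∨y (generate F) (generate G) ∘ ⊆-closure B
       , C.y≤x∨y (generate F) (generate G) ∘ ⊆-closure B ]′ ∘ ∈-++⁻ F))
    (C.∨-least {generate F} {generate G} {generate (F ++ G)}
      (closure-least B (proj₂ (generate (F ++ G))) (⊆-closure B ∘ ∈-++⁺ˡ))
      (closure-least B (proj₂ (generate (F ++ G))) (⊆-closure B ∘ ∈-++⁺ʳ F)))

  -- The list depends on the proof of compactness, so equal closed sets may receive different lists;
  -- `⋁-cong` makes up for this.
  generators : K.Carrier → List X
  generators (A , compact) = proj₁ (compact⇒finitelyGenerated B {A} compact)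

  generators-generate : ∀ A → proj₁ A C.≈ generate (generators A)
  generators-generate (A , compact) = proj₂ (compact⇒finitelyGenerated B {A} compact)

  ⋁-cong : ∀ F G → generate F C.≈ generate G → ⋁ F Ω.≈ ⋁ G
  ⋁-cong F G (F≤G , G≤F) = Ω.antisym {⋁ F} {⋁ G} (⋁-mono F G F≤G) (⋁-mono G F G≤F)

  ⋁-injective : ∀ F G → ⋁ F Ω.≈ ⋁ G → generate F C.≈ generate G
  ⋁-injective F G F≈G = C.antisym {generate F} {generate G}
    (⋁-cancel F G (Ω.reflexive {⋁ F} {⋁ G} F≈G))
    (⋁-cancel G F (Ω.reflexive {⋁ G} {⋁ F} (Ω.Eq.sym {⋁ F} {⋁ G} F≈G)))

  K↪Ω : K B ↪ Ω[η]
  K↪Ω = ⋁ ∘ generators , record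
    { isMagmaHomomorphism = record
      { isRelHomomorphism = record
        { cong = λ {A} {A′} A≈A′ → ⋁-cong (generators A) (generators A′) (begin
            generate (generators A)     ≈⟨ generators-generate A ⟨
            proj₁ A                     ≈⟨ A≈A′ ⟩
            proj₁ A′                    ≈⟨ generators-generate A′ ⟩
            generate (generators A′)    ∎)
        }
      ; homo = λ A A′ →
          let F = generators A ; G = generators A′ ; H = generators (A K.∨ A′)
          in Ω.Eq.trans {⋁ H} {⋁ (F ++ G)} {⋁ F Ω.∨ ⋁ G}
               -- The list chosen for the join need not be `F ++ G`, but both generate the same
               -- closed set.
               (⋁-cong H (F ++ G) (begin
                 generate H                    ≈⟨ generators-generate (A K.∨ A′) ⟨
                 proj₁ A C.∨ proj₁ A′          ≈⟨ ∨-cong (C B) {proj₁ A} {generate F} {proj₁ A′} {generate G}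
                                                    (generators-generate A) (generators-generate A′) ⟩
                 generate F C.∨ generate G     ≈⟨ generate-++ F G ⟨
                 generate (F ++ G)             ∎))
               (⋁-++ F G)
      }
    ; injective = λ {A} {A′} eq → begin
        proj₁ A                     ≈⟨ generators-generate A ⟩
        generate (generators A)     ≈⟨ ⋁-injective (generators A) (generators A′) eq ⟩
        generate (generators A′)    ≈⟨ generators-generate A′ ⟨
        proj₁ A′                    ∎
    }
    where open SetoidReasoning (Poset.Eq.setoid C.poset)

  -- The embedding of Ω(η) into K(C(B)).

  Box : X → X → Pred X 0ℓ
  Box x y z = z ≤₁ x × z ≤₂ y

  -- The two hypotheses put both corners inside the box, which is therefore the closure of {x, y}
  -- and so compact.
  box : ∀ x y → y ≤₁ x → x ≤₂ y → K.Carrier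
  box x y y≤x x≤y = A , finitelyGenerated⇒compact B {A} (x ∷ y ∷ [] , to , from)
    where
    A : C.Carrier
    A = Box x y , (_≤₁ x) , (_≤₂ y) , ≤₁.trans , ≤₂.trans , id , id

    to : ∀ {z} → Box x y z → closure B (_∈ x ∷ y ∷ []) z
    to (z≤x , z≤y) = (x , here refl , z≤x) , (y , there (here refl) , z≤y)

    from : ∀ {z} → closure B (_∈ x ∷ y ∷ []) z → Box x y z
    from = closure-least B (proj₂ A) λ
      { (here refl)         → ≤₁.refl , x≤y
      ; (there (here refl)) → y≤x , ≤₂.refl
      }

  module _ (copy : ContainsCopyOfℚ chain₂) where
    private
      g = proj₁ copy
      module g = IsOrderMonomorphism (proj₂ copy)

    bound : ℕ → ℕ
    bound n = max 0 (map (index ∘ g) (fractions (2 ℕ.^ n)))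

    index≤bound : ∀ n {r} → IsDyadicIn[0,1⟩ r → IsInteger (2^ n · r) → index (g r) ℕ.≤ bound n
    index≤bound n d i = All.lookup (xs≤max 0 (map (index ∘ g) (fractions (2 ℕ.^ n))))
      (∈-map⁺ (index ∘ g) (∈-fractions n d i))

    far : ∀ k → ∃[ i ] k ℕ.≤ index (g (negative i))
    far = injective⇒unbounded (index ∘ g ∘ negative)
      (λ eq → negative-injective (g.injective (index-injective eq)))

    threshold : ℕ → ℕ
    q : ℕ → ℚ
    q n = negative (proj₁ (far (threshold n)))
    threshold zero    = bound 0
    -- The `suc` makes the chosen images strictly increasing in the first order, so that `n` can be
    -- recovered from `q n`.
    threshold (suc n) = bound (suc n) ℕ.⊔ suc (index (g (q n)))

    threshold≤ : ∀ n → threshold n ℕ.≤ index (g (q n))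
    threshold≤ n = proj₂ (far (threshold n))

    bound≤ : ∀ n → bound n ℕ.≤ index (g (q n))
    bound≤ zero    = threshold≤ zero
    bound≤ (suc n) = ℕ.≤-trans (ℕ.m≤m⊔n (bound (suc n)) _) (threshold≤ (suc n))

    q-strict : ∀ {m n} → m ℕ.< n → index (g (q m)) ℕ.< index (g (q n))
    q-strict {m} {suc n} (s≤s m≤n) = ℕ.<-≤-trans (step (ℕ.m≤n⇒m<n∨m≡n m≤n))
      (ℕ.≤-trans (ℕ.m≤n⊔m (bound (suc n)) _) (threshold≤ (suc n)))
      where
      step : m ℕ.< n ⊎ m ≡ n → index (g (q m)) ℕ.< suc (index (g (q n)))
      step (inj₁ m<n)  = ℕ.m<n⇒m<1+n (q-strict m<n)
      step (inj₂ refl) = ℕ.n<1+n _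

    q-mono : ∀ {m n} → m ℕ.≤ n → g (q m) ≤₁ g (q n)
    q-mono {m} m≤n with ℕ.m≤n⇒m<n∨m≡n m≤n
    ... | inj₁ m<n  = index-cancel (ℕ.<⇒≤ (q-strict m<n))
    ... | inj₂ refl = ≤₁.refl

    q-cancel : ∀ {m n} → g (q m) ≤₁ g (q n) → m ℕ.≤ n
    q-cancel gm≤gn = ℕ.≮⇒≥ (λ n<m → ℕ.<⇒≱ (q-strict n<m) (index-mono gm≤gn))

    left : ∀ n {r} → IsDyadicIn[0,1⟩ r → IsInteger (2^ n · r) → g r ≤₁ g (q n)
    left n d i = index-cancel (ℕ.≤-trans (index≤bound n d i) (bound≤ n))

    right : ∀ n {r} → IsDyadicIn[0,1⟩ r → g (q n) ≤₂ g r
    right n d = g.mono (ℚ.≤-trans (ℚ.<⇒≤ (ℚ.negative⁻¹ (q n))) (IsDyadicIn[0,1⟩.0≤r d))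

    embed : Ω.Carrier → K.Carrier
    embed ((n , r , d) , i) = box (g (q n)) (g r) (left n d i) (right n d)

    -- Each maximum is one of its arguments, so either corner of the box for the join is a corner of
    -- one of the two given boxes. The two corners may come from different boxes, hence the separate
    -- witnesses `first` and `second`.
    embed-homo : ∀ u v → embed (u Ω.∨ v) K.≈ embed u K.∨ embed v
    embed-homo u@((m , r , d) , i) v@((n , s , e) , j) = to , from
      where
      corner₁ : (w : Ω.Carrier) → proj₁ (proj₁ (embed w)) (g (q (proj₁ (proj₁ w))))
      corner₁ ((n , r , d) , i) = ≤₁.refl , right n d

      corner₂ : (w : Ω.Carrier) → proj₁ (proj₁ (embed w)) (g (proj₁ (proj₂ (proj₁ w))))
      corner₂ ((n , r , d) , i) = left n d i , ≤₂.refl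

      to : embed (u Ω.∨ v) K.≤ (embed u K.∨ embed v)
      to (z≤q , z≤g) = first , second
        where
        first : ∃[ y ] (Box (g (q m)) (g r) y ⊎ Box (g (q n)) (g s) y) × _ ≤₁ y
        first with Max.⊔-sel ℕ.≤-totalOrder m n
        ... | inj₁ eq = g (q m) , inj₁ (corner₁ u) , subst (λ k → _ ≤₁ g (q k)) eq z≤q
        ... | inj₂ eq = g (q n) , inj₂ (corner₁ v) , subst (λ k → _ ≤₁ g (q k)) eq z≤q

        second : ∃[ y ] (Box (g (q m)) (g r) y ⊎ Box (g (q n)) (g s) y) × _ ≤₂ y
        second with Max.⊔-sel D (r , d) (s , e)
        ... | inj₁ eq = g r , inj₁ (corner₂ u) , subst (λ k → _ ≤₂ g k) eq z≤g
        ... | inj₂ eq = g s , inj₂ (corner₂ v) , subst (λ k → _ ≤₂ g k) eq z≤g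

      from : (embed u K.∨ embed v) K.≤ embed (u Ω.∨ v)
      from = K.∨-least {embed u} {embed v} {embed (u Ω.∨ v)}
        (λ (z≤q , z≤g) → ≤₁.trans z≤q (q-mono (proj₁ (Ω.x≤x∨y u v))) , ≤₂.trans z≤g (g.mono (proj₂ (Ω.x≤x∨y u v))))
        (λ (z≤q , z≤g) → ≤₁.trans z≤q (q-mono (proj₁ (Ω.y≤x∨y u v))) , ≤₂.trans z≤g (g.mono (proj₂ (Ω.y≤x∨y u v))))

    -- The inclusion is tested at the two corners of the smaller box: one yields the inequality of
    -- levels, the other that of rationals.
    embed-cancel : ∀ u v → embed u K.≤ embed v → u Ω.≤ v
    embed-cancel ((m , r , d) , i) ((n , s , e) , j) u≤v =
        q-cancel (proj₁ (u≤v (≤₁.refl , right m d)))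
      , g.cancel (proj₂ (u≤v (left m d i , ≤₂.refl)))

    -- The box depends on the level and the rational only, not on the proofs attached to them.
    embed-cong : ∀ u v → u Ω.≈ v → embed u K.≈ embed v
    embed-cong ((m , r , d) , i) ((n , s , e) , j) (refl , refl) = id , id

    Ω↪K : Ω[η] ↪ K B
    Ω↪K = embed , record
      { isMagmaHomomorphism = record
        { isRelHomomorphism = record { cong = λ {u} {v} → embed-cong u v }
        ; homo = embed-homo
        }
      ; injective = λ {u} {v} (u≤v , v≤u) →
          Ω.antisym {u} {v} (embed-cancel u v u≤v) (embed-cancel v u v≤u)
      }

-- Transfer of both embeddings along the isomorphism with K(C(B)).

theorem8p3 : ∀ {c ℓ₁ ℓ₂} (S : JoinSemilattice c ℓ₁ ℓ₂) → 𝓛D S → Equimorphic Ω[η] S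
theorem8p3 S (B , ω , copy , S≅K) =
    ↪-trans {L = Ω[η]} {M = K B} {N = S} (Ω↪K B ω copy) (≅⇒↩ {L = S} {M = K B} S≅K)
  , ↪-trans {L = S} {M = K B} {N = Ω[η]} (≅⇒↪ {L = S} {M = K B} S≅K) (K↪Ω B ω)
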